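{- There is an absolute constant $c>0$ such that the following holds. Let $\mathcal{A}$ be a local $(1,\tfrac14)$-Lipschitz filter over the hypercube $\{0,1\}^d$ for functions with range $[0,r]$. Then for all even integers $r\ge4$ and all integers $d\ge 2^{16}r$, there exists a function $f:\{0,1\}^d\to[0,r]$ such that the worst-case (over queries and random seeds) number of lookups that $\mathcal{A}$ makes on input $f$ is at least $(d/r)^{c r}$.
   Context: The hypercube $\{0,1\}^d$ is the graph where two points are adjacent iff they differ in exactly one coordinate; its distance is the Hamming distance $|x-y|$. A function $g$ is Lipschitz if $|g(x)-g(y)|\le|x-y|$ for all $x,y$. A local $(1,\tfrac14)$-Lipschitz filter is a randomized algorithm $\mathcal{A}(x,\rho)$ that gets lookup (oracle) access to $f:\{0,1\}^d\to[0,r]$, a query $x\in\{0,1\}^d$ and a random seed $\rho$, such that with probability at least $3/4$ over $\rho$, the map $x\mapsto\mathcal{A}(x,\rho)$ is a Lipschitz function $g_\rho$, and moreover $g_\rho=f$ whenever $f$ is Lipschitz. A lookup is an oracle call to $f$. -}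

module Defs where

open import Data.Bool using (Bool; true; false; _xor_)
open import Data.Fin using (Fin)
open import Data.Fin.Subset using (Subset; _∈_) renaming (∣_∣ to card)
open import Data.Integer using (+_) renaming (∣_∣ to ∣_∣ℤ)
open import Data.Nat as ℕ using (ℕ; zero; suc; NonZero)
import Data.Nat.Properties as ℕₚ
open import Data.Product using (Σ; ∃-syntax; _×_; _,_)
open import Data.Rational as ℚ using (ℚ; 0ℚ; ½; ↥_; ↧ₙ_)
import Data.Rational.Properties as ℚₚ
open import Data.Rational.Solver using (module +-*-Solver)
open import Data.Sum using (inj₁; inj₂)
open import Data.Vec using (Vec; []; _∷_; zipWith)
import Data.Vec.Functional as Vector
open import Relation.Binary.PropositionalEquality using (_≡_; refl; sym; cong; subst)

-- Real numbers: Cauchy sequences of rationals, with equality and order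
-- those of the limits.  _≈ᴿ_ plays the role of equality of reals.

IsCauchy : (ℕ → ℚ) → Set
IsCauchy s = ∀ ε → 0ℚ ℚ.< ε →
  ∃[ N ] (∀ m n → N ℕ.≤ m → N ℕ.≤ n → ℚ.∣ s m ℚ.- s n ∣ ℚ.< ε)

record ℝ : Set where
  constructor mkℝ
  field
    seq    : ℕ → ℚ
    cauchy : IsCauchy seq

open ℝ public

infix 4 _≈ᴿ_ _≤ᴿ_

_≈ᴿ_ : ℝ → ℝ → Set
x ≈ᴿ y = ∀ ε → 0ℚ ℚ.< ε →
  ∃[ N ] (∀ n → N ℕ.≤ n → ℚ.∣ seq x n ℚ.- seq y n ∣ ℚ.< ε)

_≤ᴿ_ : ℝ → ℝ → Set
x ≤ᴿ y = ∀ ε → 0ℚ ℚ.< ε →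
  ∃[ N ] (∀ n → N ℕ.≤ n → seq x n ℚ.< seq y n ℚ.+ ε)

fromℚ : ℚ → ℝ
fromℚ q = mkℝ (λ _ → q) λ ε 0<ε →
  0 , λ _ _ _ _ → subst (λ z → ℚ.∣ z ∣ ℚ.< ε) (sym (ℚₚ.+-inverseʳ q)) 0<ε

fromℕ : ℕ → ℝ
fromℕ n = fromℚ (+ n ℚ./ 1)

private
  half-pos : ∀ ε → 0ℚ ℚ.< ε → 0ℚ ℚ.< ½ ℚ.* ε
  half-pos ε 0<ε = subst (ℚ._< ½ ℚ.* ε) (ℚₚ.*-zeroʳ ½) (ℚₚ.*-monoʳ-<-pos ½ 0<ε)

  halves : ∀ ε → ½ ℚ.* ε ℚ.+ ½ ℚ.* ε ≡ ε
  halves = solve 1 (λ e → con ½ :* e :+ con ½ :* e := e) refl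
    where open +-*-Solver

  interchange : ∀ a b c d →
    (a ℚ.- b) ℚ.- (c ℚ.- d) ≡ (a ℚ.- c) ℚ.- (b ℚ.- d)
  interchange = solve 4 (λ a b c d →
    (a :- b) :- (c :- d) := (a :- c) :- (b :- d)) refl
    where open +-*-Solver

  ∣∣-≤ : ∀ a b → ℚ.∣ a ∣ ℚ.- ℚ.∣ b ∣ ℚ.≤ ℚ.∣ a ℚ.- b ∣
  ∣∣-≤ a b = begin
    ℚ.∣ a ∣ ℚ.- ℚ.∣ b ∣
      ≡⟨ cong (λ z → ℚ.∣ z ∣ ℚ.- ℚ.∣ b ∣) (split a b) ⟩
    ℚ.∣ (a ℚ.- b) ℚ.+ b ∣ ℚ.- ℚ.∣ b ∣
      ≤⟨ ℚₚ.+-monoˡ-≤ (ℚ.- ℚ.∣ b ∣) (ℚₚ.∣p+q∣≤∣p∣+∣q∣ (a ℚ.- b) b) ⟩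
    (ℚ.∣ a ℚ.- b ∣ ℚ.+ ℚ.∣ b ∣) ℚ.- ℚ.∣ b ∣
      ≡⟨ cancel ℚ.∣ a ℚ.- b ∣ ℚ.∣ b ∣ ⟩
    ℚ.∣ a ℚ.- b ∣ ∎
    where
    open ℚₚ.≤-Reasoning
    open +-*-Solver
    split : ∀ a b → a ≡ (a ℚ.- b) ℚ.+ b
    split = solve 2 (λ a b → a := (a :- b) :+ b) refl
    cancel : ∀ a b → (a ℚ.+ b) ℚ.- b ≡ a
    cancel = solve 2 (λ a b → (a :+ b) :- b := a) refl

  neg-sub : ∀ a b → ℚ.- (a ℚ.- b) ≡ b ℚ.- a
  neg-sub = solve 2 (λ a b → :- (a :- b) := b :- a) refl
    where open +-*-Solver

  ∣∣-lipschitz : ∀ a b → ℚ.∣ ℚ.∣ a ∣ ℚ.- ℚ.∣ b ∣ ∣ ℚ.≤ ℚ.∣ a ℚ.- b ∣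
  ∣∣-lipschitz a b with ℚₚ.∣p∣≡p∨∣p∣≡-p (ℚ.∣ a ∣ ℚ.- ℚ.∣ b ∣)
  ... | inj₁ eq = subst (ℚ._≤ ℚ.∣ a ℚ.- b ∣) (sym eq) (∣∣-≤ a b)
  ... | inj₂ eq = begin
    ℚ.∣ ℚ.∣ a ∣ ℚ.- ℚ.∣ b ∣ ∣  ≡⟨ eq ⟩
    ℚ.- (ℚ.∣ a ∣ ℚ.- ℚ.∣ b ∣)  ≡⟨ neg-sub ℚ.∣ a ∣ ℚ.∣ b ∣ ⟩
    ℚ.∣ b ∣ ℚ.- ℚ.∣ a ∣        ≤⟨ ∣∣-≤ b a ⟩
    ℚ.∣ b ℚ.- a ∣              ≡⟨ cong ℚ.∣_∣ (neg-sub a b) ⟨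
    ℚ.∣ ℚ.- (a ℚ.- b) ∣        ≡⟨ ℚₚ.∣-p∣≡∣p∣ (a ℚ.- b) ⟩
    ℚ.∣ a ℚ.- b ∣              ∎
    where open ℚₚ.≤-Reasoning

infixl 6 _-ᴿ_

_-ᴿ_ : ℝ → ℝ → ℝ
x -ᴿ y = mkℝ (λ n → seq x n ℚ.- seq y n) λ ε 0<ε →
  let (M , hM) = cauchy x (½ ℚ.* ε) (half-pos ε 0<ε)
      (N , hN) = cauchy y (½ ℚ.* ε) (half-pos ε 0<ε)
  in M ℕ.⊔ N , λ m n p q → bound ε m n
       (hM m n (ℕₚ.m⊔n≤o⇒m≤o M N p) (ℕₚ.m⊔n≤o⇒m≤o M N q))
       (hN m n (ℕₚ.m⊔n≤o⇒n≤o M N p) (ℕₚ.m⊔n≤o⇒n≤o M N q))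
  where
  open ℚₚ.≤-Reasoning
  bound : ∀ ε m n →
    ℚ.∣ seq x m ℚ.- seq x n ∣ ℚ.< ½ ℚ.* ε →
    ℚ.∣ seq y m ℚ.- seq y n ∣ ℚ.< ½ ℚ.* ε →
    ℚ.∣ (seq x m ℚ.- seq y m) ℚ.- (seq x n ℚ.- seq y n) ∣ ℚ.< ε
  bound ε m n hx hy = begin-strict
    ℚ.∣ (seq x m ℚ.- seq y m) ℚ.- (seq x n ℚ.- seq y n) ∣
      ≡⟨ cong ℚ.∣_∣ (interchange (seq x m) (seq y m) (seq x n) (seq y n)) ⟩
    ℚ.∣ (seq x m ℚ.- seq x n) ℚ.- (seq y m ℚ.- seq y n) ∣
      ≤⟨ ℚₚ.∣p-q∣≤∣p∣+∣q∣ (seq x m ℚ.- seq x n) (seq y m ℚ.- seq y n) ⟩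
    ℚ.∣ seq x m ℚ.- seq x n ∣ ℚ.+ ℚ.∣ seq y m ℚ.- seq y n ∣
      <⟨ ℚₚ.+-mono-< hx hy ⟩
    ½ ℚ.* ε ℚ.+ ½ ℚ.* ε
      ≡⟨ halves ε ⟩
    ε ∎

∣_∣ᴿ : ℝ → ℝ
∣ x ∣ᴿ = mkℝ (λ n → ℚ.∣ seq x n ∣) λ ε 0<ε →
  let (N , h) = cauchy x ε 0<ε
  in N , λ m n p q → ℚₚ.≤-<-trans (∣∣-lipschitz (seq x m) (seq x n)) (h m n p q)

record Interval (r : ℕ) : Set where
  constructor interval
  field
    value : ℝ
    lower : fromℕ 0 ≤ᴿ value
    upper : value ≤ᴿ fromℕ r

open Interval public

Cube : ℕ → Set
Cube d = Vec Bool d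

-- Hamming distance: the number of `true` entries of the coordinatewise xor.
hamming : ∀ {d} → Cube d → Cube d → ℕ
hamming x y = card (zipWith _xor_ x y)

IsLipschitz : ∀ {d} → (Cube d → ℝ) → Set
IsLipschitz g = ∀ x y → ∣ g x -ᴿ g y ∣ᴿ ≤ᴿ fromℕ (hamming x y)

-- A deterministic computation with oracle access to a function
-- Cube d → [0,r] and a real output; the point of each oracle call may depend
-- on all earlier answers.
data Computation (d r : ℕ) : Set where
  output : ℝ → Computation d r
  lookup : Cube d → (Interval r → Computation d r) → Computation d r

module _ {d r : ℕ} (f : Cube d → Interval r) where

  result : Computation d r → ℝ
  result (output v)   = v
  result (lookup z k) = result (k (f z))

  lookups : Computation d r → ℕ
  lookups (output _)   = 0
  lookups (lookup z k) = suc (lookups (k (f z)))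

-- The seed is uniform on Fin seeds.
record LocalAlgorithm (d r : ℕ) : Set where
  field
    seeds          : ℕ
    seeds-nonempty : NonZero seeds
    run            : Cube d → Fin seeds → Computation d r

open LocalAlgorithm public

-- P holds with probability at least 3/4 under the uniform distribution on
-- Fin n.  P need not be decidable, so the event is given through a subset of
-- at least (3/4)n seeds on which P holds.
Prob≥¾ : ∀ {n} → (Fin n → Set) → Set
Prob≥¾ {n} P =
  Σ (Subset n) λ E → (∀ ρ → ρ ∈ E → P ρ) × 3 ℕ.* n ℕ.≤ 4 ℕ.* card E

filtered : ∀ {d r} (A : LocalAlgorithm d r) →
  (Cube d → Interval r) → Fin (seeds A) → Cube d → ℝ
filtered A f ρ x = result f (run A x ρ)

IsLipschitzFilter : ∀ {d r} → LocalAlgorithm d r → Set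
IsLipschitzFilter {d} {r} A = (f : Cube d → Interval r) →
  Prob≥¾ λ ρ →
    IsLipschitz (filtered A f ρ) ×
    (IsLipschitz (λ x → value (f x)) → ∀ x → filtered A f ρ x ≈ᴿ value (f x))

maxCube : ∀ d → (Cube d → ℕ) → ℕ
maxCube zero    h = h []
maxCube (suc d) h = maxCube d (λ x → h (false ∷ x)) ℕ.⊔ maxCube d (λ x → h (true ∷ x))

maxFin : ∀ n → (Fin n → ℕ) → ℕ
maxFin n h = Vector.foldr ℕ._⊔_ 0 h

worstCaseLookups : ∀ {d r} → LocalAlgorithm d r → (Cube d → Interval r) → ℕ
worstCaseLookups {d} A f =
  maxCube d λ x → maxFin (seeds A) λ ρ → lookups f (run A x ρ)

-- L ≥ (d/r)^(c r) for r > 0 and c = p/q > 0 in lowest terms: raising both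
-- sides to the q-th power and clearing denominators gives
-- d^(p r) ≤ L^q r^(p r).
AtLeastRatioPower : (c : ℚ) (d r L : ℕ) → Set
AtLeastRatioPower c d r L = d ℕ.^ (p ℕ.* r) ℕ.≤ L ℕ.^ q ℕ.* r ℕ.^ (p ℕ.* r)
  where
  p = ∣ ↥ c ∣ℤ
  q = ↧ₙ c

{-# OPTIONS --safe #-}
module Submission where

-- Write r = 2h.  For points x, y at distance r − 1, glue the Lipschitz
-- functions min(h, |z − x|), a well with bottom 0 at x, and
-- h + (h ∸ |z − y|), a peak with top r at y, into one function.  The filter
-- keeps the well alone and the peak alone, but must modify the glued function
-- at x or at y; so for at least 1/4 of the seeds the run at x on the well
-- looks within distance h − 1 of y, or the run at y on the peak looks within
-- distance h − 1 of x.
--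
-- Let y = x ⊕ u, where u has one true entry in each of r − 1 blocks of length
-- m = ⌊d/r⌋.  There are m^(r−1) such u, and a point z is within h − 1 of
-- x ⊕ u for at most 2^(r−1) m^(h−1) of them.  Counting the triples (x, u, ρ)
-- with a hit gives m^(r−1) ≤ 8 L 2^(r−1) m^(h−1), where L is the largest number
-- of lookups on a well or a peak, and hence L ≥ (d/r)^(r/4).

open import Defs
open import Algebra.Properties.CommutativeSemigroup using (interchange)
open import Data.Bool using (Bool; true; false; _xor_; if_then_else_; T)
open import Data.Fin as Fin using (Fin)
open import Data.Fin.Subset using (Subset) renaming (∣_∣ to card)
import Data.Integer as ℤ
import Data.Integer.Properties as ℤₚ
open import Data.List using (List; []; _∷_; [_]; _++_; map; length; allFin; cartesianProductWith)
open import Data.List.Membership.Propositional using (_∈_)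
open import Data.List.Membership.Propositional.Properties using (∈-map⁺; ∈-map⁻; ∈-++⁺ˡ; ∈-++⁺ʳ; ∈-cartesianProductWith⁻)
open import Data.List.Properties using (length-map; length-tabulate; map-tabulate; map-++; map-∘)
import Data.List.Relation.Unary.All as All
open import Data.List.Relation.Unary.Any using (here; there)
open import Data.Nat using (ℕ; zero; suc; _≤_; _<_; _*_; _^_; _+_; _∸_; _⊓_; _⊔_; _≤ᵇ_; _/_; _%_; z≤n; s≤s; s≤s⁻¹; NonZero; >-nonZero)
open import Data.Nat.Coprimality using (1-coprimeTo) renaming (sym to coprime-sym)
open import Data.Nat.Divisibility using (_∣_; divides)
open import Data.Nat.DivMod using (m≡m%n+[m/n]*n; m%n<n; m*n/n≡m; /-monoˡ-≤)
open import Data.Nat.ListAction using (sum)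
open import Data.Nat.ListAction.Properties using (sum-++)
open import Data.Nat.Properties
open import Data.List.Extrema ≤-totalOrder using (argmax; f[xs]≤f[argmax])
open import Data.Nat.Solver using (module +-*-Solver)
open import Data.Product using (Σ; _×_; _,_; proj₁; proj₂; map₂)
open import Data.Rational as ℚ using (ℚ; 0ℚ; mkℚ) renaming (_<_ to _<ℚ_)
import Data.Rational.Properties as ℚₚ
import Data.Rational.Solver as ℚ-Solver
open import Data.Sum using (inj₁; inj₂)
open import Data.Vec as Vec using ([]; _∷_; zipWith; replicate)
open import Data.Vec.Properties using (lookup⇒[]=)
open import Function using (_∘_)
open import Relation.Binary.PropositionalEquality using (_≡_; refl; sym; trans; cong; cong₂; subst; module ≡-Reasoning)
open import Relation.Nullary using (¬_; contradiction)

-- Finite sums over lists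

private
  variable
    X Y Z : Set

∑ : List X → (X → ℕ) → ℕ
∑ xs f = sum (map f xs)

∑-mono-≤ : ∀ (xs : List X) {f g : X → ℕ} → (∀ {a} → a ∈ xs → f a ≤ g a) → ∑ xs f ≤ ∑ xs g
∑-mono-≤ []       _   = z≤n
∑-mono-≤ (_ ∷ xs) f≤g = +-mono-≤ (f≤g (here refl)) (∑-mono-≤ xs (f≤g ∘ there))

∑-cong : ∀ (xs : List X) {f g : X → ℕ} → (∀ a → f a ≡ g a) → ∑ xs f ≡ ∑ xs g
∑-cong []       _   = refl
∑-cong (a ∷ xs) f≡g = cong₂ _+_ (f≡g a) (∑-cong xs f≡g)

∑-distrib-+ : ∀ (xs : List X) (f g : X → ℕ) → ∑ xs (λ a → f a + g a) ≡ ∑ xs f + ∑ xs g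
∑-distrib-+ []       f g = refl
∑-distrib-+ (a ∷ xs) f g = trans (cong (f a + g a +_) (∑-distrib-+ xs f g))
  (interchange +-commutativeSemigroup (f a) (g a) (∑ xs f) (∑ xs g))

∑-const : ∀ (xs : List X) c → ∑ xs (λ _ → c) ≡ length xs * c
∑-const []       c = refl
∑-const (_ ∷ xs) c = cong (c +_) (∑-const xs c)

∑-distribˡ-* : ∀ (xs : List X) c (f : X → ℕ) → ∑ xs (λ a → c * f a) ≡ c * ∑ xs f
∑-distribˡ-* []       c f = sym (*-zeroʳ c)
∑-distribˡ-* (a ∷ xs) c f = trans (cong (c * f a +_) (∑-distribˡ-* xs c f))
  (sym (*-distribˡ-+ c (f a) (∑ xs f)))

∑-comm : ∀ (xs : List X) (ys : List Y) (f : X → Y → ℕ) →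
  ∑ xs (λ a → ∑ ys (f a)) ≡ ∑ ys (λ b → ∑ xs (λ a → f a b))
∑-comm []       ys f = sym (trans (∑-const ys 0) (*-zeroʳ (length ys)))
∑-comm (a ∷ xs) ys f = trans (cong (∑ ys (f a) +_) (∑-comm xs ys f))
  (sym (∑-distrib-+ ys (f a) (λ b → ∑ xs (λ a → f a b))))

∑-++ : ∀ (xs ys : List X) (f : X → ℕ) → ∑ (xs ++ ys) f ≡ ∑ xs f + ∑ ys f
∑-++ xs ys f = trans (cong sum (map-++ f xs ys)) (sum-++ (map f xs) (map f ys))

∑-map : ∀ (g : X → Y) (xs : List X) (f : Y → ℕ) → ∑ (map g xs) f ≡ ∑ xs (f ∘ g)
∑-map g xs f = cong sum (sym (map-∘ xs))

∑-cartesianProductWith : ∀ (g : X → Y → Z) xs ys (f : Z → ℕ) →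
  ∑ (cartesianProductWith g xs ys) f ≡ ∑ xs (λ a → ∑ ys (λ b → f (g a b)))
∑-cartesianProductWith g []       ys f = refl
∑-cartesianProductWith g (a ∷ xs) ys f =
  trans (∑-++ (map (g a) ys) (cartesianProductWith g xs ys) f)
    (cong₂ _+_ (∑-map (g a) ys f) (∑-cartesianProductWith g xs ys f))

∑≡0⇒f≡0 : ∀ (xs : List X) {f : X → ℕ} → ∑ xs f ≡ 0 → ∀ {a} → a ∈ xs → f a ≡ 0
∑≡0⇒f≡0 (b ∷ xs) {f} eq (here refl) = m+n≡0⇒m≡0 (f b) eq
∑≡0⇒f≡0 (b ∷ xs) {f} eq (there a∈)  = ∑≡0⇒f≡0 xs (m+n≡0⇒n≡0 (f b) eq) a∈

∑-bound : ∀ (xs : List X) {f : X → ℕ} {c} → (∀ {a} → a ∈ xs → f a ≤ c) → ∑ xs f ≤ length xs * c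
∑-bound xs {c = c} f≤c = ≤-trans (∑-mono-≤ xs f≤c) (≤-reflexive (∑-const xs c))

-- Indicators and cardinalities

𝟙 : Bool → ℕ
𝟙 b = if b then 1 else 0

𝟙≤1 : ∀ b → 𝟙 b ≤ 1
𝟙≤1 false = z≤n
𝟙≤1 true  = ≤-refl

𝟙-mono-≤ : ∀ {b c} → (T b → T c) → 𝟙 b ≤ 𝟙 c
𝟙-mono-≤ {false}         _   = z≤n
𝟙-mono-≤ {true}  {true}  _   = ≤-refl
𝟙-mono-≤ {true}  {false} b⇒c = contradiction (b⇒c _) (λ ())

card-∷ : ∀ {n} b (p : Subset n) → card (b ∷ p) ≡ 𝟙 b + card p
card-∷ false p = refl
card-∷ true  p = refl

card≡∑ : ∀ {n} (E : Subset n) → card E ≡ ∑ (allFin n) (λ ρ → 𝟙 (Vec.lookup E ρ))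
card≡∑ []      = refl
card≡∑ (b ∷ E) = trans (card-∷ b E) (cong (𝟙 b +_) (trans (card≡∑ E) (cong sum
  (trans (map-tabulate (λ ρ → ρ) (λ ρ → 𝟙 (Vec.lookup E ρ)))
         (sym (map-tabulate Fin.suc (λ ρ → 𝟙 (Vec.lookup (b ∷ E) ρ))))))))

-- The cube as the group (ℤ/2)^d

infixl 6 _⊕_

_⊕_ : ∀ {d} → Cube d → Cube d → Cube d
_⊕_ = zipWith _xor_

⊕-cancelʳ : ∀ {d} (x u : Cube d) → (x ⊕ u) ⊕ u ≡ x
⊕-cancelʳ []      []      = refl
⊕-cancelʳ (a ∷ x) (b ∷ u) = cong₂ _∷_ (bit a b) (⊕-cancelʳ x u)
  where
  bit : ∀ a b → (a xor b) xor b ≡ a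
  bit false false = refl
  bit false true  = refl
  bit true  false = refl
  bit true  true  = refl

⊕-cancelˡ : ∀ {d} (x u : Cube d) → x ⊕ (x ⊕ u) ≡ u
⊕-cancelˡ []      []      = refl
⊕-cancelˡ (a ∷ x) (b ∷ u) = cong₂ _∷_ (bit a b) (⊕-cancelˡ x u)
  where
  bit : ∀ a b → a xor (a xor b) ≡ b
  bit false false = refl
  bit false true  = refl
  bit true  false = refl
  bit true  true  = refl

card-++ : ∀ {m n} (p : Subset m) (q : Subset n) → card (p Vec.++ q) ≡ card p + card q
card-++ []      q = refl
card-++ (b ∷ p) q = trans (card-∷ b (p Vec.++ q)) (trans (cong (𝟙 b +_) (card-++ p q))
  (trans (sym (+-assoc (𝟙 b) (card p) (card q))) (cong (_+ card q) (sym (card-∷ b p)))))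

card-replicate-false : ∀ n → card (replicate n false) ≡ 0
card-replicate-false zero    = refl
card-replicate-false (suc n) = card-replicate-false n

hamming-∷ : ∀ {d} a b (x y : Cube d) → hamming (a ∷ x) (b ∷ y) ≡ 𝟙 (a xor b) + hamming x y
hamming-∷ a b x y = card-∷ (a xor b) (x ⊕ y)

hamming-refl : ∀ {d} (x : Cube d) → hamming x x ≡ 0
hamming-refl []          = refl
hamming-refl (false ∷ x) = hamming-refl x
hamming-refl (true ∷ x)  = hamming-refl x

hamming-sym : ∀ {d} (x y : Cube d) → hamming x y ≡ hamming y x
hamming-sym []      []      = refl
hamming-sym (a ∷ x) (b ∷ y) = trans (hamming-∷ a b x y)
  (trans (cong₂ _+_ (bit a b) (hamming-sym x y)) (sym (hamming-∷ b a y x)))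
  where
  bit : ∀ a b → 𝟙 (a xor b) ≡ 𝟙 (b xor a)
  bit false false = refl
  bit false true  = refl
  bit true  false = refl
  bit true  true  = refl

hamming-triangle : ∀ {d} (x y z : Cube d) → hamming x z ≤ hamming x y + hamming y z
hamming-triangle []      []      []      = z≤n
hamming-triangle (a ∷ x) (b ∷ y) (c ∷ z) = begin
  hamming (a ∷ x) (c ∷ z)                                  ≡⟨ hamming-∷ a c x z ⟩
  𝟙 (a xor c) + hamming x z                                ≤⟨ +-mono-≤ (bit a b c) (hamming-triangle x y z) ⟩
  (𝟙 (a xor b) + 𝟙 (b xor c)) + (hamming x y + hamming y z)
    ≡⟨ interchange +-commutativeSemigroup (𝟙 (a xor b)) (𝟙 (b xor c)) (hamming x y) (hamming y z) ⟩
  (𝟙 (a xor b) + hamming x y) + (𝟙 (b xor c) + hamming y z)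
    ≡⟨ cong₂ _+_ (hamming-∷ a b x y) (hamming-∷ b c y z) ⟨
  hamming (a ∷ x) (b ∷ y) + hamming (b ∷ y) (c ∷ z)        ∎
  where
  open ≤-Reasoning
  bit : ∀ a b c → 𝟙 (a xor c) ≤ 𝟙 (a xor b) + 𝟙 (b xor c)
  bit false false c     = ≤-refl
  bit false true  false = z≤n
  bit false true  true  = ≤-refl
  bit true  true  c     = ≤-refl
  bit true  false true  = z≤n
  bit true  false false = ≤-refl

hamming-++ : ∀ {m n} (z x u : Cube m) (z′ x′ u′ : Cube n) →
  hamming (z Vec.++ z′) ((x Vec.++ x′) ⊕ (u Vec.++ u′)) ≡ hamming z (x ⊕ u) + hamming z′ (x′ ⊕ u′)
hamming-++ []      []      []      z′ x′ u′ = refl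
hamming-++ (a ∷ z) (b ∷ x) (c ∷ u) z′ x′ u′ = begin
  hamming ((a ∷ z) Vec.++ z′) (((b ∷ x) Vec.++ x′) ⊕ ((c ∷ u) Vec.++ u′))
    ≡⟨ hamming-∷ a (b xor c) (z Vec.++ z′) ((x Vec.++ x′) ⊕ (u Vec.++ u′)) ⟩
  𝟙 (a xor (b xor c)) + hamming (z Vec.++ z′) ((x Vec.++ x′) ⊕ (u Vec.++ u′))
    ≡⟨ cong (𝟙 (a xor (b xor c)) +_) (hamming-++ z x u z′ x′ u′) ⟩
  𝟙 (a xor (b xor c)) + (hamming z (x ⊕ u) + hamming z′ (x′ ⊕ u′))
    ≡⟨ +-assoc (𝟙 (a xor (b xor c))) _ _ ⟨
  𝟙 (a xor (b xor c)) + hamming z (x ⊕ u) + hamming z′ (x′ ⊕ u′)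
    ≡⟨ cong (_+ hamming z′ (x′ ⊕ u′)) (hamming-∷ a (b xor c) z (x ⊕ u)) ⟨
  hamming (a ∷ z) ((b ∷ x) ⊕ (c ∷ u)) + hamming z′ (x′ ⊕ u′) ∎
  where open ≡-Reasoning

-- Sums over the whole cube

cubes : ∀ d → List (Cube d)
cubes zero    = [ [] ]
cubes (suc d) = map (false ∷_) (cubes d) ++ map (true ∷_) (cubes d)

∑-cubes-suc : ∀ d (f : Cube (suc d) → ℕ) →
  ∑ (cubes (suc d)) f ≡ ∑ (cubes d) (f ∘ (false ∷_)) + ∑ (cubes d) (f ∘ (true ∷_))
∑-cubes-suc d f = trans (∑-++ (map (false ∷_) (cubes d)) _ f)
  (cong₂ _+_ (∑-map (false ∷_) (cubes d) f) (∑-map (true ∷_) (cubes d) f))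

-- Translation by `u` permutes the cube: a `true` entry of `u` swaps the two halves in that
-- coordinate. This allows sums over `x` to be recentred at `y = x ⊕ u`.
∑-translate : ∀ {d} (u : Cube d) (f : Cube d → ℕ) → ∑ (cubes d) (λ x → f (x ⊕ u)) ≡ ∑ (cubes d) f
∑-translate []          f = refl
∑-translate {suc d} (false ∷ u) f = trans (∑-cubes-suc d (λ x → f (x ⊕ (false ∷ u))))
  (trans (cong₂ _+_ (∑-translate u (f ∘ (false ∷_))) (∑-translate u (f ∘ (true ∷_))))
         (sym (∑-cubes-suc d f)))
∑-translate {suc d} (true ∷ u)  f = trans (∑-cubes-suc d (λ x → f (x ⊕ (true ∷ u))))
  (trans (cong₂ _+_ (∑-translate u (f ∘ (true ∷_))) (∑-translate u (f ∘ (false ∷_))))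
  (trans (+-comm (∑ (cubes d) (f ∘ (true ∷_))) _) (sym (∑-cubes-suc d f))))

∈-cubes : ∀ {d} (x : Cube d) → x ∈ cubes d
∈-cubes []          = here refl
∈-cubes (false ∷ x) = ∈-++⁺ˡ (∈-map⁺ (false ∷_) (∈-cubes x))
∈-cubes (true ∷ x)  = ∈-++⁺ʳ _ (∈-map⁺ (true ∷_) (∈-cubes x))

-- Vectors with one true entry in each of n blocks of length m

units : ∀ m → List (Cube m)
units zero    = []
units (suc m) = (true ∷ replicate m false) ∷ map (false ∷_) (units m)

length-units : ∀ m → length (units m) ≡ m
length-units zero    = refl
length-units (suc m) = cong suc (trans (length-map (false ∷_) (units m)) (length-units m))

card-units : ∀ m {u} → u ∈ units m → card u ≡ 1
card-units (suc m) (here refl) = cong suc (card-replicate-false m)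
card-units (suc m) (there u∈) with ∈-map⁻ (false ∷_) u∈
... | _ , v∈ , refl = card-units m v∈

-- Distance 0 forces `u = x ⊕ z`, and `units m` has no repetitions.
units-unique : ∀ {m} (z x : Cube m) → ∑ (units m) (λ u → 𝟙 (hamming z (x ⊕ u) ≤ᵇ 0)) ≤ 1
units-unique []          []          = z≤n
units-unique {suc m} (a ∷ z) (b ∷ x) =
  subst (λ s → 𝟙 (hamming (a ∷ z) ((b xor true) ∷ (x ⊕ replicate m false)) ≤ᵇ 0) + s ≤ 1)
    (sym (∑-map (false ∷_) (units m) _)) (bits a b)
  where
  none : ∑ (units m) (λ _ → 0) ≡ 0
  none = trans (∑-const (units m) 0) (*-zeroʳ (length (units m)))
  alone : ∀ c → 𝟙 c + ∑ (units m) (λ _ → 0) ≤ 1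
  alone c = ≤-trans (≤-reflexive (trans (cong (𝟙 c +_) none) (+-identityʳ (𝟙 c)))) (𝟙≤1 c)
  bits : ∀ a b → 𝟙 (hamming (a ∷ z) ((b xor true) ∷ (x ⊕ replicate m false)) ≤ᵇ 0)
           + ∑ (units m) (λ u → 𝟙 (hamming (a ∷ z) ((b ∷ x) ⊕ (false ∷ u)) ≤ᵇ 0)) ≤ 1
  -- Equal leading bits rule out the head unit; unequal ones rule out all the others.
  bits false false = units-unique z x
  bits false true  = alone (hamming z (x ⊕ replicate m false) ≤ᵇ 0)
  bits true  false = alone (hamming z (x ⊕ replicate m false) ≤ᵇ 0)
  bits true  true  = units-unique z x

module Masks (m e : ℕ) where

  -- The last `e` coordinates lie in no block and are `false` in every mask. The recursion makes
  -- `blocks (suc n)` unfold to `m + blocks n`, the length of a concatenation.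
  blocks : ℕ → ℕ
  blocks zero    = e
  blocks (suc n) = m + blocks n

  blocks≡ : ∀ n → blocks n ≡ n * m + e
  blocks≡ zero    = refl
  blocks≡ (suc n) = trans (cong (m +_) (blocks≡ n)) (sym (+-assoc m (n * m) e))

  masks : ∀ n → List (Cube (blocks n))
  masks zero    = [ replicate e false ]
  masks (suc n) = cartesianProductWith Vec._++_ (units m) (masks n)

  length-masks : ∀ n → length (masks n) ≡ m ^ n
  length-masks zero    = refl
  length-masks (suc n) = begin
    length (masks (suc n))
      ≡⟨ *-identityʳ _ ⟨
    length (masks (suc n)) * 1
      ≡⟨ ∑-const (masks (suc n)) 1 ⟨
    ∑ (masks (suc n)) (λ _ → 1)
      ≡⟨ ∑-cartesianProductWith Vec._++_ (units m) (masks n) (λ _ → 1) ⟩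
    ∑ (units m) (λ _ → ∑ (masks n) (λ _ → 1))
      ≡⟨ ∑-const (units m) _ ⟩
    length (units m) * ∑ (masks n) (λ _ → 1)
      ≡⟨ cong₂ _*_ (length-units m) (trans (∑-const (masks n) 1) (trans (*-identityʳ _) (length-masks n))) ⟩
    m * m ^ n ∎
    where open ≡-Reasoning

  card-masks : ∀ n {u} → u ∈ masks n → card u ≡ n
  card-masks zero    (here refl) = card-replicate-false e
  card-masks (suc n) u∈ with ∈-cartesianProductWith⁻ Vec._++_ (units m) (masks n) u∈
  ... | v , w , v∈ , w∈ , refl = trans (card-++ v w) (cong₂ _+_ (card-units m v∈) (card-masks n w∈))

  hamming-mask : ∀ n {u} (x : Cube (blocks n)) → u ∈ masks n → hamming x (x ⊕ u) ≡ n
  hamming-mask n x u∈ = trans (cong card (⊕-cancelˡ x _)) (card-masks n u∈)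

  nearMasks : ∀ n k (z x : Cube (blocks n)) → ℕ
  nearMasks n k z x = ∑ (masks n) (λ u → 𝟙 (hamming z (x ⊕ u) ≤ᵇ k))

  -- A block on which z and x ⊕ u agree determines the entry of u there; a
  -- block on which they differ consumes one unit of the distance budget k.
  nearMasks-≤ : ∀ .{{_ : NonZero m}} n k z x → nearMasks n k z x ≤ 2 ^ n * m ^ k
  nearMasks-≤ zero k z x = begin
    𝟙 (hamming z (x ⊕ replicate e false) ≤ᵇ k) + 0  ≡⟨ +-identityʳ _ ⟩
    𝟙 (hamming z (x ⊕ replicate e false) ≤ᵇ k)      ≤⟨ 𝟙≤1 _ ⟩
    1                                               ≤⟨ m^n>0 m k ⟩
    m ^ k                                           ≡⟨ *-identityˡ (m ^ k) ⟨
    1 * m ^ k                                       ∎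
    where open ≤-Reasoning
  nearMasks-≤ (suc n) k z x with Vec.splitAt m z | Vec.splitAt m x
  ... | z₁ , z₂ , refl | x₁ , x₂ , refl = begin
    nearMasks (suc n) k (z₁ Vec.++ z₂) (x₁ Vec.++ x₂)
      ≡⟨ ∑-cartesianProductWith Vec._++_ (units m) (masks n) _ ⟩
    ∑ (units m) (λ v → ∑ (masks n) (λ w →
      𝟙 (hamming (z₁ Vec.++ z₂) ((x₁ Vec.++ x₂) ⊕ (v Vec.++ w)) ≤ᵇ k)))
      ≡⟨ ∑-cong (units m) (λ v → ∑-cong (masks n) (λ w →
           cong (λ δ → 𝟙 (δ ≤ᵇ k)) (hamming-++ z₁ x₁ v z₂ x₂ w))) ⟩
    ∑ (units m) (λ v → ∑ (masks n) (λ w → 𝟙 (hamming z₁ (x₁ ⊕ v) + hamming z₂ (x₂ ⊕ w) ≤ᵇ k)))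
      ≤⟨ ∑-mono-≤ (units m) (λ {v} _ → byFirstBlock (hamming z₁ (x₁ ⊕ v)) k) ⟩
    ∑ (units m) (λ v → 2 ^ n * m ^ k * 𝟙 (hamming z₁ (x₁ ⊕ v) ≤ᵇ 0) + differing k)
      ≡⟨ ∑-distrib-+ (units m) _ (λ _ → differing k) ⟩
    ∑ (units m) (λ v → 2 ^ n * m ^ k * 𝟙 (hamming z₁ (x₁ ⊕ v) ≤ᵇ 0)) + ∑ (units m) (λ _ → differing k)
      ≡⟨ cong₂ _+_ (∑-distribˡ-* (units m) (2 ^ n * m ^ k) _)
           (trans (∑-const (units m) (differing k)) (cong (_* differing k) (length-units m))) ⟩
    2 ^ n * m ^ k * ∑ (units m) (λ v → 𝟙 (hamming z₁ (x₁ ⊕ v) ≤ᵇ 0)) + m * differing k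
      -- Agreement and difference on the first block contribute at most `2 ^ n * m ^ k` each, whence
      -- one factor 2 per block.
      ≤⟨ +-mono-≤ (*-monoʳ-≤ (2 ^ n * m ^ k) (units-unique z₁ x₁)) (m*differing k) ⟩
    2 ^ n * m ^ k * 1 + 2 ^ n * m ^ k
      ≡⟨ solve 2 (λ a b → a :* b :* con 1 :+ a :* b := (con 2 :* a) :* b) refl (2 ^ n) (m ^ k) ⟩
    2 ^ suc n * m ^ k ∎
    where
    open ≤-Reasoning
    open +-*-Solver
    differing : ℕ → ℕ
    -- With budget 0 the first block cannot differ at all.
    differing zero    = 0
    differing (suc k) = 2 ^ n * m ^ k
    m*differing : ∀ k → m * differing k ≤ 2 ^ n * m ^ k
    m*differing zero    = ≤-trans (≤-reflexive (*-zeroʳ m)) z≤n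
    m*differing (suc k) = ≤-reflexive
      (solve 3 (λ a b c → a :* (b :* c) := b :* (a :* c)) refl m (2 ^ n) (m ^ k))
    byFirstBlock : ∀ δ k → ∑ (masks n) (λ w → 𝟙 (δ + hamming z₂ (x₂ ⊕ w) ≤ᵇ k))
                     ≤ 2 ^ n * m ^ k * 𝟙 (δ ≤ᵇ 0) + differing k
    byFirstBlock zero    k       = begin
      nearMasks n k z₂ x₂                 ≤⟨ nearMasks-≤ n k z₂ x₂ ⟩
      2 ^ n * m ^ k                       ≡⟨ *-identityʳ _ ⟨
      2 ^ n * m ^ k * 1                   ≤⟨ m≤m+n _ (differing k) ⟩
      2 ^ n * m ^ k * 1 + differing k     ∎
    byFirstBlock (suc δ) zero    = ≤-trans
      (≤-reflexive (trans (∑-const (masks n) 0) (*-zeroʳ (length (masks n))))) z≤n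
    byFirstBlock (suc δ) (suc k) = begin
      ∑ (masks n) (λ w → 𝟙 (suc δ + hamming z₂ (x₂ ⊕ w) ≤ᵇ suc k))
        -- Only one unit of the distance `suc δ` is charged to the budget.
        ≤⟨ ∑-mono-≤ (masks n) (λ _ → 𝟙-mono-≤
             (λ near → ≤⇒≤ᵇ (m+n≤o⇒n≤o δ (s≤s⁻¹ (≤ᵇ⇒≤ _ (suc k) near))))) ⟩
      nearMasks n k z₂ x₂  ≤⟨ nearMasks-≤ n k z₂ x₂ ⟩
      2 ^ n * m ^ k        ≤⟨ m≤n+m _ (2 ^ n * m ^ suc k * 0) ⟩
      2 ^ n * m ^ suc k * 0 + 2 ^ n * m ^ k ∎

-- Naturals as rationals and reals

ι : ℕ → ℚ
ι n = ℤ.+ n ℚ./ 1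

ι-homo-+ : ∀ a b → ι (a + b) ≡ ι a ℚ.+ ι b
ι-homo-+ a b = sym (begin
  ι a ℚ.+ ι b
    ≡⟨ cong₂ ℚ._+_ (canonical a) (canonical b) ⟩
  mkℚ (ℤ.+ a) 0 (coprime-sym (1-coprimeTo a)) ℚ.+ mkℚ (ℤ.+ b) 0 (coprime-sym (1-coprimeTo b))
    ≡⟨ cong₂ (λ i j → (i ℤ.+ j) ℚ./ 1) (ℤₚ.*-identityʳ (ℤ.+ a)) (ℤₚ.*-identityʳ (ℤ.+ b)) ⟩
  ι (a + b) ∎)
  where
  open ≡-Reasoning
  -- Normalisation by the gcd does not compute on a variable; with the fraction in explicit lowest
  -- terms, the addition does.
  canonical : ∀ n → ι n ≡ mkℚ (ℤ.+ n) 0 (coprime-sym (1-coprimeTo n))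
  canonical n = ℚₚ.normalize-coprime (coprime-sym (1-coprimeTo n))

ι-mono-≤ : ∀ {a b} → a ≤ b → ι a ℚ.≤ ι b
ι-mono-≤ {a} a≤b with m≤n⇒∃[o]m+o≡n a≤b
... | c , refl = subst (ι a ℚ.≤_) (sym (ι-homo-+ a c))
  (subst (ℚ._≤ ι a ℚ.+ ι c) (ℚₚ.+-identityʳ (ι a))
    (ℚₚ.+-monoʳ-≤ (ι a) (ℚₚ.nonNegative⁻¹ (ι c) {{ℚₚ.normalize-nonNeg c 1}})))

p≤∣p∣ : ∀ p → p ℚ.≤ ℚ.∣ p ∣
p≤∣p∣ (mkℚ (ℤ.+ _) _ _)        = ℚₚ.≤-refl
p≤∣p∣ p@(mkℚ ℤ.-[1+ _ ] _ _)   = ℚₚ.≤-trans (ℚₚ.nonPositive⁻¹ p) (ℚₚ.0≤∣p∣ p)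

-p≤∣p∣ : ∀ p → ℚ.- p ℚ.≤ ℚ.∣ p ∣
-p≤∣p∣ p = subst (ℚ.- p ℚ.≤_) (ℚₚ.∣-p∣≡∣p∣ p) (p≤∣p∣ (ℚ.- p))

ι-ι≤ : ∀ a b c → a ≤ b + c → ι a ℚ.- ι b ℚ.≤ ι c
ι-ι≤ a b c a≤b+c = begin
  ι a ℚ.- ι b           ≤⟨ ℚₚ.+-monoˡ-≤ (ℚ.- ι b) (ι-mono-≤ a≤b+c) ⟩
  ι (b + c) ℚ.- ι b     ≡⟨ cong (ℚ._- ι b) (ι-homo-+ b c) ⟩
  ι b ℚ.+ ι c ℚ.- ι b   ≡⟨ solve 2 (λ p q → p :+ q :- p := q) refl (ι b) (ι c) ⟩
  ι c                   ∎
  where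
  open ℚₚ.≤-Reasoning
  open ℚ-Solver.+-*-Solver

∣ι-ι∣≤ : ∀ a b c → a ≤ b + c → b ≤ a + c → ℚ.∣ ι a ℚ.- ι b ∣ ℚ.≤ ι c
∣ι-ι∣≤ a b c a≤b+c b≤a+c with ℚₚ.∣p∣≡p∨∣p∣≡-p (ι a ℚ.- ι b)
... | inj₁ eq = subst (ℚ._≤ ι c) (sym eq) (ι-ι≤ a b c a≤b+c)
... | inj₂ eq = subst (ℚ._≤ ι c)
  (sym (trans eq (solve 2 (λ p q → :- (p :- q) := q :- p) refl (ι a) (ι b)))) (ι-ι≤ b a c b≤a+c)
  where open ℚ-Solver.+-*-Solver

≤⇒≤ᴿ : ∀ x y → (∀ n → seq x n ℚ.≤ seq y n) → x ≤ᴿ y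
≤⇒≤ᴿ x y x≤y ε 0<ε = 0 , λ n _ → ℚₚ.≤-<-trans (x≤y n)
  (subst (ℚ._< seq y n ℚ.+ ε) (ℚₚ.+-identityʳ (seq y n)) (ℚₚ.+-monoʳ-< (seq y n) 0<ε))

lipschitz-fromℕ : ∀ {d} (v : Cube d → ℕ) → (∀ x y → v x ≤ v y + hamming x y) →
  IsLipschitz (λ x → fromℕ (v x))
lipschitz-fromℕ v v-lip x y = ≤⇒≤ᴿ ∣ fromℕ (v x) -ᴿ fromℕ (v y) ∣ᴿ (fromℕ (hamming x y))
  (λ _ → ∣ι-ι∣≤ (v x) (v y) (hamming x y) (v-lip x y) (subst (λ δ → v y ≤ v x + δ) (hamming-sym y x) (v-lip y x)))

-- Were `hamming x y < b`, the gap between these naturals would be at least 1. The Lipschitz bound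
-- and the two limits, each taken with tolerance 1/3, hold strictly at a common index, so their
-- errors add up to less than 1.
lipschitz-separation : ∀ {d} {g : Cube d → ℝ} {x y b} → IsLipschitz g →
  g x ≈ᴿ fromℕ 0 → g y ≈ᴿ fromℕ b → b ≤ hamming x y
lipschitz-separation {g = g} {x} {y} {b} g-lip gx≈0 gy≈b = ≮⇒≥ absurd
  where
  third = ℤ.+ 1 ℚ./ 3
  0<third : 0ℚ <ℚ third
  0<third = ℚₚ.positive⁻¹ third
  absurd : ¬ (hamming x y < b)
  absurd a<b with g-lip x y third 0<third | gx≈0 third 0<third | gy≈b third 0<third
  ... | N₁ , h₁ | N₂ , h₂ | N₃ , h₃ = ℚₚ.<-irrefl refl (begin-strict
    ι b
      ≡⟨ telescope (ι b) gy gx ⟩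
    (ℚ.- (gy ℚ.- ι b) ℚ.- (gx ℚ.- gy)) ℚ.+ (gx ℚ.- 0ℚ)
      ≤⟨ ℚₚ.+-mono-≤ (ℚₚ.+-mono-≤ (-p≤∣p∣ (gy ℚ.- ι b)) (-p≤∣p∣ (gx ℚ.- gy))) (p≤∣p∣ (gx ℚ.- 0ℚ)) ⟩
    (ℚ.∣ gy ℚ.- ι b ∣ ℚ.+ ℚ.∣ gx ℚ.- gy ∣) ℚ.+ ℚ.∣ gx ℚ.- 0ℚ ∣
      <⟨ ℚₚ.+-mono-< (ℚₚ.+-mono-< (h₃ N N₃≤N) (h₁ N N₁≤N)) (h₂ N N₂≤N) ⟩
    (third ℚ.+ (ι (hamming x y) ℚ.+ third)) ℚ.+ third
      ≡⟨ collect (ι (hamming x y)) ⟩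
    ι 1 ℚ.+ ι (hamming x y)
      ≡⟨ ι-homo-+ 1 (hamming x y) ⟨
    ι (suc (hamming x y))
      ≤⟨ ι-mono-≤ a<b ⟩
    ι b ∎)
    where
    open ℚₚ.≤-Reasoning
    open ℚ-Solver.+-*-Solver
    N = N₁ ⊔ N₂ ⊔ N₃
    N₁≤N : N₁ ≤ N
    N₁≤N = ≤-trans (m≤m⊔n N₁ N₂) (m≤m⊔n (N₁ ⊔ N₂) N₃)
    N₂≤N : N₂ ≤ N
    N₂≤N = ≤-trans (m≤n⊔m N₁ N₂) (m≤m⊔n (N₁ ⊔ N₂) N₃)
    N₃≤N : N₃ ≤ N
    N₃≤N = m≤n⊔m (N₁ ⊔ N₂) N₃
    gx = seq (g x) N
    gy = seq (g y) N
    telescope : ∀ b y x → b ≡ (ℚ.- (y ℚ.- b) ℚ.- (x ℚ.- y)) ℚ.+ (x ℚ.- 0ℚ)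
    telescope = solve 3 (λ b y x → b := (:- (y :- b) :- (x :- y)) :+ (x :- con 0ℚ)) refl
    collect : ∀ a → (third ℚ.+ (a ℚ.+ third)) ℚ.+ third ≡ ι 1 ℚ.+ a
    collect = solve 1 (λ a → (con third :+ (a :+ con third)) :+ con third := con (ι 1) :+ a) refl

-- Lookups of a computation

trace : ∀ {d r} → (Cube d → Interval r) → Computation d r → List (Cube d)
trace f (output _)   = []
trace f (lookup z k) = z ∷ trace f (k (f z))

length-trace : ∀ {d r} (f : Cube d → Interval r) c → length (trace f c) ≡ lookups f c
length-trace f (output _)   = refl
length-trace f (lookup z k) = cong suc (length-trace f (k (f z)))

-- Equal answers keep an adaptive computation on the same path. The answers must be equal as
-- representatives, not merely as reals, because a continuation may inspect the Cauchy sequence it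
-- receives.
result-cong : ∀ {d r} (f g : Cube d → Interval r) c → (∀ {z} → z ∈ trace f c → g z ≡ f z) →
  result g c ≡ result f c
result-cong f g (output _)   _   = refl
result-cong f g (lookup z k) g≡f = trans (cong (result g ∘ k) (g≡f (here refl)))
  (result-cong f g (k (f z)) (g≡f ∘ there))

≤-maxCube : ∀ {d} (v : Cube d → ℕ) x → v x ≤ maxCube d v
≤-maxCube v []          = ≤-refl
≤-maxCube v (false ∷ x) = ≤-trans (≤-maxCube (v ∘ (false ∷_)) x) (m≤m⊔n _ _)
≤-maxCube v (true ∷ x)  = ≤-trans (≤-maxCube (v ∘ (true ∷_)) x) (m≤n⊔m _ _)

≤-maxFin : ∀ {n} (v : Fin n → ℕ) ρ → v ρ ≤ maxFin n v
≤-maxFin v Fin.zero    = m≤m⊔n _ _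
≤-maxFin v (Fin.suc ρ) = ≤-trans (≤-maxFin (v ∘ Fin.suc) ρ) (m≤n⊔m _ _)

lookups≤worstCaseLookups : ∀ {d r} (A : LocalAlgorithm d r) f x ρ →
  lookups f (run A x ρ) ≤ worstCaseLookups A f
lookups≤worstCaseLookups A f x ρ = ≤-trans
  (≤-maxFin (λ ρ → lookups f (run A x ρ)) ρ)
  (≤-maxCube (λ x → maxFin (seeds A) λ ρ → lookups f (run A x ρ)) x)

-- The hard functions

natural : ∀ {r} v → v ≤ r → Interval r
natural {r} v v≤r = interval (fromℕ v)
  (≤⇒≤ᴿ (fromℕ 0) (fromℕ v) (λ _ → ι-mono-≤ {0} {v} z≤n))
  (≤⇒≤ᴿ (fromℕ v) (fromℕ r) (λ _ → ι-mono-≤ v≤r))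

-- Propositional equality of the interval points, as oracle answers require it; the bound proofs are
-- irrelevant.
natural-cong : ∀ {r} v w (p : v ≤ r) (q : w ≤ r) → v ≡ w → natural v p ≡ natural w q
natural-cong v v p q refl = cong (natural v) (≤-irrelevant p q)

module Bumps (k : ℕ) {d : ℕ} where

  private
    h = suc k

  well-value peak-value : Cube d → Cube d → ℕ
  well-value x z = h ⊓ hamming z x
  peak-value y z = h + (h ∸ hamming z y)

  well-value-≤ : ∀ x z → well-value x z ≤ h * 2
  well-value-≤ x z = ≤-trans (m⊓n≤m h (hamming z x)) (m≤m*n h 2)

  peak-value-≤ : ∀ y z → peak-value y z ≤ h * 2
  peak-value-≤ y z = ≤-trans (+-monoʳ-≤ h (m∸n≤m h (hamming z y)))
    (≤-reflexive (trans (cong (h +_) (sym (+-identityʳ h))) (*-comm 2 h)))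

  well peak : Cube d → Cube d → Interval (h * 2)
  well x z = natural (well-value x z) (well-value-≤ x z)
  peak y z = natural (peak-value y z) (peak-value-≤ y z)

  -- Beyond radius `k` both bumps are constantly `h`, so this function coincides with `well x` away
  -- from `y` and with `peak y` away from `x`.
  wellAndPeak : Cube d → Cube d → Cube d → Interval (h * 2)
  wellAndPeak x y z = if hamming z x ≤ᵇ k then well x z else peak y z

  well-lipschitz : ∀ x → IsLipschitz (λ z → value (well x z))
  well-lipschitz x = lipschitz-fromℕ (well-value x) λ z w → begin
    h ⊓ hamming z x
      ≤⟨ ⊓-mono-≤ (m≤m+n h (hamming z w)) (≤-trans (hamming-triangle z w x)
           (≤-reflexive (+-comm (hamming z w) (hamming w x)))) ⟩
    (h + hamming z w) ⊓ (hamming w x + hamming z w)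
      ≡⟨ +-distribʳ-⊓ (hamming z w) h (hamming w x) ⟨
    h ⊓ hamming w x + hamming z w ∎
    where open ≤-Reasoning

  peak-lipschitz : ∀ y → IsLipschitz (λ z → value (peak y z))
  peak-lipschitz y = lipschitz-fromℕ (peak-value y) λ z w → begin
    h + (h ∸ hamming z y)
      ≤⟨ +-monoʳ-≤ h (m≤n+o⇒m∸n≤o h (hamming z y) (drop z w)) ⟩
    h + ((h ∸ hamming w y) + hamming z w)
      ≡⟨ +-assoc h (h ∸ hamming w y) (hamming z w) ⟨
    h + (h ∸ hamming w y) + hamming z w ∎
    where
    open ≤-Reasoning
    open +-*-Solver
    drop : ∀ z w → h ≤ hamming z y + ((h ∸ hamming w y) + hamming z w)
    drop z w = begin
      h
        ≤⟨ m≤n+m∸n h (hamming w y) ⟩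
      hamming w y + (h ∸ hamming w y)
        ≤⟨ +-monoˡ-≤ (h ∸ hamming w y) (hamming-triangle w z y) ⟩
      hamming w z + hamming z y + (h ∸ hamming w y)
        ≡⟨ cong (λ δ → δ + hamming z y + (h ∸ hamming w y)) (hamming-sym w z) ⟩
      hamming z w + hamming z y + (h ∸ hamming w y)
        ≡⟨ solve 3 (λ a b c → a :+ b :+ c := b :+ (c :+ a)) refl (hamming z w) (hamming z y) (h ∸ hamming w y) ⟩
      hamming z y + ((h ∸ hamming w y) + hamming z w) ∎

  well-bottom : ∀ x → well-value x x ≡ 0
  well-bottom x = cong (h ⊓_) (hamming-refl x)

  peak-top : ∀ y → peak-value y y ≡ h + h
  peak-top y = cong (λ δ → h + (h ∸ δ)) (hamming-refl y)

  -- A vanishing indicator is the form in which a zero count of hits delivers the distance bound.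
  far : ∀ {z w : Cube d} → 𝟙 (hamming z w ≤ᵇ k) ≡ 0 → k < hamming z w
  far {z} {w} eq = ≰⇒> λ near → absurd (≤⇒≤ᵇ near) eq
    where
    absurd : ∀ {b} → T b → ¬ (𝟙 b ≡ 0)
    absurd {true} _ ()

  wellAndPeak≡peak : ∀ x y z → 𝟙 (hamming z x ≤ᵇ k) ≡ 0 → wellAndPeak x y z ≡ peak y z
  wellAndPeak≡peak x y z = choose (hamming z x ≤ᵇ k)
    where
    choose : ∀ b {p q : Interval (h * 2)} → 𝟙 b ≡ 0 → (if b then p else q) ≡ q
    choose false _ = refl

  wellAndPeak≡well : ∀ x y z → 𝟙 (hamming z y ≤ᵇ k) ≡ 0 → wellAndPeak x y z ≡ well x z
  wellAndPeak≡well x y z eq = choose (hamming z x ≤ᵇ k) λ eq′ →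
    natural-cong (peak-value y z) (well-value x z) (peak-value-≤ y z) (well-value-≤ x z) (level eq′)
    where
    open ≡-Reasoning
    choose : ∀ b {p q : Interval (h * 2)} → (𝟙 b ≡ 0 → q ≡ p) → (if b then p else q) ≡ p
    choose false q≡p = q≡p refl
    choose true  _   = refl
    level : 𝟙 (hamming z x ≤ᵇ k) ≡ 0 → peak-value y z ≡ well-value x z
    level eq′ = begin
      h + (h ∸ hamming z y)  ≡⟨ cong (h +_) (m≤n⇒m∸n≡0 (far {z} {y} eq)) ⟩
      h + 0                  ≡⟨ +-identityʳ h ⟩
      h                      ≡⟨ m≤n⇒m⊓n≡m (far {z} {x} eq′) ⟨
      h ⊓ hamming z x        ∎

-- Seeds on which three events hold together

-- The three good sets have total size at least 9n/4. A seed lies in at most two of them unless it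
-- lies in all three, where `H` is at least 1; so the total is at most 2n plus the sum of `H`.
three-events : ∀ {n} {P₁ P₂ P₃ : Fin n → Set} (H : Fin n → ℕ) →
  Prob≥¾ P₁ → Prob≥¾ P₂ → Prob≥¾ P₃ → (∀ ρ → P₁ ρ → P₂ ρ → P₃ ρ → 1 ≤ H ρ) →
  n ≤ 4 * ∑ (allFin n) H
three-events {n} H (E₁ , good₁ , p₁) (E₂ , good₂ , p₂) (E₃ , good₃ , p₃) H≥1 = +-cancelˡ-≤ (8 * n) _ _ (begin
  8 * n + n
    ≡⟨ solve 1 (λ s → con 8 :* s :+ s := con 3 :* s :+ con 3 :* s :+ con 3 :* s) refl n ⟩
  3 * n + 3 * n + 3 * n
    ≤⟨ +-mono-≤ (+-mono-≤ p₁ p₂) p₃ ⟩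
  4 * card E₁ + 4 * card E₂ + 4 * card E₃
    ≡⟨ solve 3 (λ a b c → con 4 :* a :+ con 4 :* b :+ con 4 :* c := con 4 :* (a :+ b :+ c)) refl
         (card E₁) (card E₂) (card E₃) ⟩
  4 * (card E₁ + card E₂ + card E₃)
    ≤⟨ *-monoʳ-≤ 4 total ⟩
  4 * (n * 2 + ∑ (allFin n) H)
    ≡⟨ solve 2 (λ s t → con 4 :* (s :* con 2 :+ t) := con 8 :* s :+ con 4 :* t) refl n (∑ (allFin n) H) ⟩
  8 * n + 4 * ∑ (allFin n) H ∎)
  where
  open ≤-Reasoning
  open +-*-Solver
  in₁ in₂ in₃ : Fin n → ℕ
  in₁ ρ = 𝟙 (Vec.lookup E₁ ρ)
  in₂ ρ = 𝟙 (Vec.lookup E₂ ρ)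
  in₃ ρ = 𝟙 (Vec.lookup E₃ ρ)
  two : ∀ b c {t} → 𝟙 b + 𝟙 c ≤ 2 + t
  two b c = ≤-trans (+-mono-≤ (𝟙≤1 b) (𝟙≤1 c)) (m≤m+n 2 _)
  pointwise : ∀ ρ → in₁ ρ + in₂ ρ + in₃ ρ ≤ 2 + H ρ
  pointwise ρ with Vec.lookup E₁ ρ in eq₁ | Vec.lookup E₂ ρ in eq₂ | Vec.lookup E₃ ρ in eq₃
  ... | false | b     | c     = two b c
  ... | true  | false | c     = two true c
  ... | true  | true  | false = two true true
  ... | true  | true  | true  = +-monoʳ-≤ 2 (H≥1 ρ (good₁ ρ (lookup⇒[]= ρ E₁ eq₁))
    (good₂ ρ (lookup⇒[]= ρ E₂ eq₂)) (good₃ ρ (lookup⇒[]= ρ E₃ eq₃)))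
  total : card E₁ + card E₂ + card E₃ ≤ n * 2 + ∑ (allFin n) H
  total = begin
    card E₁ + card E₂ + card E₃
      ≡⟨ cong₂ _+_ (cong₂ _+_ (card≡∑ E₁) (card≡∑ E₂)) (card≡∑ E₃) ⟩
    ∑ (allFin n) in₁ + ∑ (allFin n) in₂ + ∑ (allFin n) in₃
      ≡⟨ cong (_+ ∑ (allFin n) in₃) (∑-distrib-+ (allFin n) in₁ in₂) ⟨
    ∑ (allFin n) (λ ρ → in₁ ρ + in₂ ρ) + ∑ (allFin n) in₃
      ≡⟨ ∑-distrib-+ (allFin n) (λ ρ → in₁ ρ + in₂ ρ) in₃ ⟨
    ∑ (allFin n) (λ ρ → in₁ ρ + in₂ ρ + in₃ ρ)
      ≤⟨ ∑-mono-≤ (allFin n) (λ {ρ} _ → pointwise ρ) ⟩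
    ∑ (allFin n) (λ ρ → 2 + H ρ)
      ≡⟨ ∑-distrib-+ (allFin n) (λ _ → 2) H ⟩
    ∑ (allFin n) (λ _ → 2) + ∑ (allFin n) H
      ≡⟨ cong (_+ ∑ (allFin n) H) (trans (∑-const (allFin n) 2) (cong (_* 2) (length-tabulate {n = n} (λ ρ → ρ)))) ⟩
    n * 2 + ∑ (allFin n) H ∎

-- Double counting of hits

module DoubleCounting (m e k : ℕ) .{{_ : NonZero m}} where
  open Masks m e
  open Bumps k

  -- This is r - 1 for r = 2(k + 1), one less than the height difference between top and bottom. In
  -- this form `suc n` unfolds to `suc k + suc k`.
  n : ℕ
  n = k + suc k

  module _ (A : LocalAlgorithm (blocks n) (suc k * 2)) (A-filter : IsLipschitzFilter A) where

    private
      S = seeds A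
      seedList = allFin S

    -- Lookups near `w` are counted with multiplicity, so that the count is a sum and can be
    -- interchanged with sums over masks and seeds.
    hits : (Cube (blocks n) → Interval (suc k * 2)) → Cube (blocks n) → Cube (blocks n) → Fin S → ℕ
    hits f x w ρ = ∑ (trace f (run A x ρ)) (λ z → 𝟙 (hamming z w ≤ᵇ k))

    agree : ∀ f g x w ρ → (∀ z → 𝟙 (hamming z w ≤ᵇ k) ≡ 0 → g z ≡ f z) →
      hits f x w ρ ≡ 0 → filtered A g ρ x ≡ filtered A f ρ x
    agree f g x w ρ g≡f none = result-cong f g (run A x ρ)
      (λ {z} z∈ → g≡f z (∑≡0⇒f≡0 (trace f (run A x ρ)) none z∈))

    -- Without hits, the filtered wellAndPeak would keep both the value 0 at x
    -- and the value 2(k+1) > n at y.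
    hits≢0 : ∀ x y ρ → hamming x y ≡ n →
      IsLipschitz (filtered A (wellAndPeak x y) ρ) →
      (∀ z → filtered A (well x) ρ z ≈ᴿ value (well x z)) →
      (∀ z → filtered A (peak y) ρ z ≈ᴿ value (peak y z)) →
      ¬ (hits (well x) x y ρ + hits (peak y) y x ρ ≡ 0)
    hits≢0 x y ρ dist lip keeps-well keeps-peak none = n≮n n (begin
      suc n            ≡⟨⟩
      suc k + suc k    ≤⟨ lipschitz-separation {g = filtered A (wellAndPeak x y) ρ} {x} {y} lip at-x at-y ⟩
      hamming x y      ≡⟨ dist ⟩
      n                ∎)
      where
      open ≤-Reasoning
      at-x : filtered A (wellAndPeak x y) ρ x ≈ᴿ fromℕ 0
      at-x = subst (_≈ᴿ fromℕ 0)
        (sym (agree (well x) (wellAndPeak x y) x y ρ (wellAndPeak≡well x y) (m+n≡0⇒m≡0 _ none)))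
        (subst (λ v → filtered A (well x) ρ x ≈ᴿ fromℕ v) (well-bottom x) (keeps-well x))
      at-y : filtered A (wellAndPeak x y) ρ y ≈ᴿ fromℕ (suc k + suc k)
      at-y = subst (_≈ᴿ fromℕ (suc k + suc k))
        (sym (agree (peak y) (wellAndPeak x y) y x ρ (wellAndPeak≡peak x y)
          (m+n≡0⇒n≡0 (hits (well x) x y ρ) none)))
        (subst (λ v → filtered A (peak y) ρ y ≈ᴿ fromℕ v) (peak-top y) (keeps-peak y))

    -- A good seed keeps `well x` and `peak y`, which are Lipschitz, and makes the filtered
    -- `wellAndPeak x y` Lipschitz. A seed good for all three must produce a hit.
    pair-hits : ∀ x y → hamming x y ≡ n →
      S ≤ 4 * (∑ seedList (hits (well x) x y) + ∑ seedList (hits (peak y) y x))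
    pair-hits x y dist = subst (λ t → S ≤ 4 * t)
      (∑-distrib-+ seedList (hits (well x) x y) (hits (peak y) y x))
      (three-events _ (A-filter (well x)) (A-filter (peak y)) (A-filter (wellAndPeak x y))
        λ ρ good₁ good₂ good₃ → n≢0⇒n>0 (hits≢0 x y ρ dist (proj₁ good₃)
          (proj₂ good₁ (well-lipschitz x)) (proj₂ good₂ (peak-lipschitz y))))

    module _ (L : ℕ) where

      private
        K = L * (2 ^ n * m ^ k)

      -- Since `f` and `x` are fixed, the trace does not depend on `u`; hence each of its at most
      -- `L` points is charged only for the masks `u` that bring `x ⊕ u` near it.
      ∑-hits-≤ : ∀ f x → (∀ ρ → lookups f (run A x ρ) ≤ L) →
        ∑ (masks n) (λ u → ∑ seedList (hits f x (x ⊕ u))) ≤ S * K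
      ∑-hits-≤ f x few = begin
        ∑ (masks n) (λ u → ∑ seedList (hits f x (x ⊕ u)))
          ≡⟨ ∑-comm (masks n) seedList (λ u ρ → hits f x (x ⊕ u) ρ) ⟩
        ∑ seedList (λ ρ → ∑ (masks n) (λ u → hits f x (x ⊕ u) ρ))
          ≤⟨ ∑-bound seedList (λ {ρ} _ → perSeed ρ) ⟩
        length seedList * K
          ≡⟨ cong (_* K) (length-tabulate {n = S} (λ ρ → ρ)) ⟩
        S * K ∎
        where
        open ≤-Reasoning
        perSeed : ∀ ρ → ∑ (masks n) (λ u → hits f x (x ⊕ u) ρ) ≤ K
        perSeed ρ = begin
          ∑ (masks n) (λ u → hits f x (x ⊕ u) ρ)
            ≡⟨ ∑-comm (masks n) (trace f (run A x ρ)) (λ u z → 𝟙 (hamming z (x ⊕ u) ≤ᵇ k)) ⟩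
          ∑ (trace f (run A x ρ)) (λ z → nearMasks n k z x)
            ≤⟨ ∑-bound (trace f (run A x ρ)) (λ {z} _ → nearMasks-≤ n k z x) ⟩
          length (trace f (run A x ρ)) * (2 ^ n * m ^ k)
            ≡⟨ cong (_* (2 ^ n * m ^ k)) (length-trace f (run A x ρ)) ⟩
          lookups f (run A x ρ) * (2 ^ n * m ^ k)
            ≤⟨ *-monoˡ-≤ (2 ^ n * m ^ k) (few ρ) ⟩
          K ∎

      -- For fixed `x` the peaks at the points `x ⊕ u` are different functions. Summing over all `x`
      -- permits regrouping their hits by the centre `y = x ⊕ u`, where the bound for a single
      -- function applies. The factor 8 is 4 from the probability times 2 from well and peak.
      masks-≤ : (∀ x ρ → lookups (well x) (run A x ρ) ≤ L) →
                (∀ y ρ → lookups (peak y) (run A y ρ) ≤ L) →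
                m ^ n ≤ 8 * K
      masks-≤ few-well few-peak = *-cancelˡ-≤ (N * S) {{N*S≢0}} (begin
        N * S * m ^ n
          ≡⟨ solve 3 (λ a s v → a :* s :* v := a :* (v :* s)) refl N S (m ^ n) ⟩
        N * (m ^ n * S)
          ≡⟨ trans (∑-const (cubes d) _) (cong (N *_) (trans (∑-const (masks n) S) (cong (_* S) (length-masks n)))) ⟨
        ∑ (cubes d) (λ _ → ∑ (masks n) (λ _ → S))
          ≤⟨ ∑-mono-≤ (cubes d) (λ {x} _ → ∑-mono-≤ (masks n) (λ {u} u∈ → pair x u u∈)) ⟩
        ∑ (cubes d) (λ x → ∑ (masks n) (λ u → 4 * (P x u + Q (x ⊕ u) u)))
          ≡⟨ ∑-cong (cubes d) (λ x → trans (∑-distribˡ-* (masks n) 4 (λ u → P x u + Q (x ⊕ u) u))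
               (cong (4 *_) (∑-distrib-+ (masks n) (P x) (λ u → Q (x ⊕ u) u)))) ⟩
        ∑ (cubes d) (λ x → 4 * (∑ (masks n) (P x) + ∑ (masks n) (λ u → Q (x ⊕ u) u)))
          ≡⟨ trans (∑-distribˡ-* (cubes d) 4 _) (cong (4 *_) (∑-distrib-+ (cubes d) _ _)) ⟩
        4 * (∑ (cubes d) (λ x → ∑ (masks n) (P x)) + ∑ (cubes d) (λ x → ∑ (masks n) (λ u → Q (x ⊕ u) u)))
          ≡⟨ cong (λ q → 4 * (∑ (cubes d) (λ x → ∑ (masks n) (P x)) + q)) recentre ⟩
        4 * (∑ (cubes d) (λ x → ∑ (masks n) (P x)) + ∑ (cubes d) (λ y → ∑ (masks n) (Q y)))
          ≤⟨ *-monoʳ-≤ 4 (+-mono-≤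
               (∑-bound (cubes d) (λ {x} _ → ∑-hits-≤ (well x) x (few-well x)))
               (∑-bound (cubes d) (λ {y} _ → ∑-hits-≤ (peak y) y (few-peak y)))) ⟩
        4 * (N * (S * K) + N * (S * K))
          ≡⟨ solve 3 (λ a s t → con 4 :* (a :* (s :* t) :+ a :* (s :* t)) := a :* s :* (con 8 :* t)) refl N S K ⟩
        N * S * (8 * K) ∎)
        where
        open ≤-Reasoning
        open +-*-Solver
        d = blocks n
        N = length (cubes d)
        N*S≢0 : NonZero (N * S)
        N*S≢0 = m*n≢0 N S {{∈⇒nonZero (∈-cubes (replicate d false))}} {{seeds-nonempty A}}
          where
          ∈⇒nonZero : ∀ {x} {xs : List (Cube d)} → x ∈ xs → NonZero (length xs)
          ∈⇒nonZero (here _)  = _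
          ∈⇒nonZero (there _) = _
        P Q : Cube d → Cube d → ℕ
        P x u = ∑ seedList (hits (well x) x (x ⊕ u))
        Q y u = ∑ seedList (hits (peak y) y (y ⊕ u))
        pair : ∀ x u → u ∈ masks n → S ≤ 4 * (P x u + Q (x ⊕ u) u)
        -- Seen from `y = x ⊕ u`, the partner `x` is `y ⊕ u`, with the same mask.
        pair x u u∈ = subst (λ w → S ≤ 4 * (P x u + ∑ seedList (hits (peak (x ⊕ u)) (x ⊕ u) w)))
          (sym (⊕-cancelʳ x u)) (pair-hits x (x ⊕ u) (hamming-mask n x u∈))
        recentre : ∑ (cubes d) (λ x → ∑ (masks n) (λ u → Q (x ⊕ u) u)) ≡ ∑ (cubes d) (λ y → ∑ (masks n) (Q y))
        recentre = trans (∑-comm (cubes d) (masks n) (λ x u → Q (x ⊕ u) u))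
          (trans (∑-cong (masks n) (λ u → ∑-translate u (λ y → Q y u)))
                 (sym (∑-comm (cubes d) (masks n) Q)))

-- Arithmetic of the final bound

^-distribʳ-* : ∀ a b n → (a * b) ^ n ≡ a ^ n * b ^ n
^-distribʳ-* a b zero    = refl
^-distribʳ-* a b (suc n) = trans (cong (a * b *_) (^-distribʳ-* a b n))
  (solve 4 (λ a b c d → a :* b :* (c :* d) := a :* c :* (b :* d)) refl a b (a ^ n) (b ^ n))
  where open +-*-Solver

-- From 2 ≤ h the factor `2 ^ (2 + h * 2)` is at most `8 ^ h`. Squaring costs `64 ^ h`, and 128 ≤ m
-- pays for this and for the 2 in `2 * m`, giving `(2 * m) ^ h ≤ L ^ 2`; squaring again yields the
-- exponent 4.
power-bound : ∀ {m h L} → 128 ≤ m → 2 ≤ h → m ^ h ≤ 2 ^ (2 + h * 2) * L → (2 * m) ^ (h * 2) ≤ L ^ 4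
power-bound {m} {h} {L} 128≤m 2≤h bound = begin
  (2 * m) ^ (h * 2)          ≡⟨ ^-*-assoc (2 * m) h 2 ⟨
  ((2 * m) ^ h) ^ 2          ≤⟨ ^-monoˡ-≤ 2 root ⟩
  (L ^ 2) ^ 2                ≡⟨ ^-*-assoc L 2 2 ⟩
  L ^ 4                      ∎
  where
  open ≤-Reasoning
  open +-*-Solver
  m^h≤8^h*L : m ^ h ≤ 8 ^ h * L
  m^h≤8^h*L = begin
    m ^ h                    ≤⟨ bound ⟩
    2 ^ (2 + h * 2) * L      ≤⟨ *-monoˡ-≤ L (^-monoʳ-≤ 2 (+-monoˡ-≤ (h * 2) 2≤h)) ⟩
    2 ^ (h + h * 2) * L      ≡⟨ cong (λ i → 2 ^ i * L) (solve 1 (λ h → h :+ h :* con 2 := con 3 :* h) refl h) ⟩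
    2 ^ (3 * h) * L          ≡⟨ cong (_* L) (^-*-assoc 2 3 h) ⟨
    8 ^ h * L                ∎
  root : (2 * m) ^ h ≤ L ^ 2
  root = *-cancelˡ-≤ (64 ^ h) {{m^n≢0 64 h}} (begin
    64 ^ h * (2 * m) ^ h     ≡⟨ ^-distribʳ-* 64 (2 * m) h ⟨
    (64 * (2 * m)) ^ h       ≡⟨ cong (_^ h) (*-assoc 64 2 m) ⟨
    (128 * m) ^ h            ≤⟨ ^-monoˡ-≤ h (*-monoˡ-≤ m 128≤m) ⟩
    (m * m) ^ h              ≡⟨ ^-distribʳ-* m m h ⟩
    m ^ h * m ^ h            ≤⟨ *-mono-≤ m^h≤8^h*L m^h≤8^h*L ⟩
    8 ^ h * L * (8 ^ h * L)  ≡⟨ solve 2 (λ a l → a :* l :* (a :* l) := a :* a :* (l :^ 2)) refl (8 ^ h) L ⟩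
    8 ^ h * 8 ^ h * L ^ 2    ≡⟨ cong (_* L ^ 2) (^-distribʳ-* 8 8 h) ⟨
    64 ^ h * L ^ 2           ∎)

masks-bound⇒power : ∀ m k L .{{_ : NonZero m}} →
  m ^ (k + suc k) ≤ 8 * (L * (2 ^ (k + suc k) * m ^ k)) → m ^ suc k ≤ 2 ^ (2 + suc k * 2) * L
masks-bound⇒power m k L bound = *-cancelˡ-≤ (m ^ k) {{m^n≢0 m k}} (begin
  m ^ k * m ^ suc k                        ≡⟨ ^-distribˡ-+-* m k (suc k) ⟨
  m ^ (k + suc k)                          ≤⟨ bound ⟩
  8 * (L * (2 ^ (k + suc k) * m ^ k))
    ≡⟨ solve 3 (λ l t v → con 8 :* (l :* (t :* v)) := v :* (con 8 :* t :* l)) refl L (2 ^ (k + suc k)) (m ^ k) ⟩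
  m ^ k * (2 ^ 3 * 2 ^ (k + suc k) * L)
    ≡⟨ cong (λ t → m ^ k * (t * L)) (^-distribˡ-+-* 2 3 (k + suc k)) ⟨
  m ^ k * (2 ^ (3 + (k + suc k)) * L)
    ≡⟨ cong (λ i → m ^ k * (2 ^ i * L))
         (solve 1 (λ k → con 3 :+ (k :+ (con 1 :+ k)) := con 2 :+ (con 1 :+ k) :* con 2) refl k) ⟩
  m ^ k * (2 ^ (2 + suc k * 2) * L) ∎)
  where
  open ≤-Reasoning
  open +-*-Solver

-- Choice of the hard function and of the block length

module _ (m e k : ℕ) .{{_ : NonZero m}} where
  open Masks m e
  open Bumps k
  open DoubleCounting m e k

  hard-function : (A : LocalAlgorithm (blocks n) (suc k * 2)) → IsLipschitzFilter A →
    Σ (Cube (blocks n) → Interval (suc k * 2)) λ f →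
      m ^ suc k ≤ 2 ^ (2 + suc k * 2) * worstCaseLookups A f
  hard-function A A-filter = f , masks-bound⇒power m k (worstCaseLookups A f)
    (masks-≤ A A-filter (worstCaseLookups A f)
      (λ x ρ → ≤-trans (lookups≤worstCaseLookups A (well x) x ρ)
        (maximal (∈-++⁺ˡ (∈-map⁺ well (∈-cubes x)))))
      (λ y ρ → ≤-trans (lookups≤worstCaseLookups A (peak y) y ρ)
        (maximal (∈-++⁺ʳ (map well (cubes _)) (∈-map⁺ peak (∈-cubes y))))))
    where
    candidates : List (Cube (blocks n) → Interval (suc k * 2))
    candidates = map well (cubes _) ++ map peak (cubes _)
    -- One function must serve for all centres: the most expensive well or peak, so that its cost
    -- bounds every other.
    f = argmax (worstCaseLookups A) (well (replicate _ false)) candidates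
    maximal : ∀ {g} → g ∈ candidates → worstCaseLookups A g ≤ worstCaseLookups A f
    maximal = All.lookup (f[xs]≤f[argmax] (well (replicate _ false)) candidates)

lower-bound : ∀ k d → 1 ≤ k → 128 * (suc k * 2) ≤ d →
  (A : LocalAlgorithm d (suc k * 2)) → IsLipschitzFilter A →
  Σ (Cube d → Interval (suc k * 2)) λ f →
    d ^ (suc k * 2) ≤ worstCaseLookups A f ^ 4 * (suc k * 2) ^ (suc k * 2)
lower-bound k d 1≤k 128r≤d A A-filter = go d≡blocks A A-filter
  where
  open ≤-Reasoning
  open +-*-Solver
  r = suc k * 2
  m = d / r
  -- Only r - 1 of the r blocks of length `m` carry mask entries; the last block joins the
  -- remainder.
  e = d % r + m
  open Masks m e
  n = k + suc k
  128≤m : 128 ≤ m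
  128≤m = ≤-trans (≤-reflexive (sym (m*n/n≡m 128 r))) (/-monoˡ-≤ r 128r≤d)
  instance
    m≢0 : NonZero m
    m≢0 = >-nonZero (≤-trans (s≤s z≤n) 128≤m)
  d≡blocks : d ≡ blocks n
  d≡blocks = trans (m≡m%n+[m/n]*n d r) (trans
    (solve 3 (λ s m k → s :+ m :* ((con 1 :+ k) :* con 2) := (k :+ (con 1 :+ k)) :* m :+ (s :+ m)) refl
      (d % r) m k)
    (sym (blocks≡ n)))
  d≤2mr : d ≤ 2 * m * r
  d≤2mr = begin
    d                  ≡⟨ m≡m%n+[m/n]*n d r ⟩
    -- The remainder is below `r`, hence at most `m * r`: rounding d/r down loses at most a factor
    -- 2.
    d % r + m * r      ≤⟨ +-monoˡ-≤ (m * r) (≤-trans (<⇒≤ (m%n<n d r)) (m≤n*m r m)) ⟩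
    m * r + m * r      ≡⟨ solve 2 (λ m r → m :* r :+ m :* r := con 2 :* m :* r) refl m r ⟩
    2 * m * r          ∎
  -- `m` and `e` depend on `d`, so `d` itself cannot be unified with `blocks n`; a fresh dimension
  -- `d′` can.
  go : ∀ {d′} → d′ ≡ blocks n → (A : LocalAlgorithm d′ r) → IsLipschitzFilter A →
    Σ (Cube d′ → Interval r) λ f → d ^ r ≤ worstCaseLookups A f ^ 4 * r ^ r
  go refl A A-filter = map₂ (λ {f} bound → begin
    d ^ r                            ≤⟨ ^-monoˡ-≤ r d≤2mr ⟩
    (2 * m * r) ^ r                  ≡⟨ ^-distribʳ-* (2 * m) r r ⟩
    (2 * m) ^ r * r ^ r              ≤⟨ *-monoˡ-≤ (r ^ r) (power-bound {h = suc k} 128≤m (s≤s 1≤k) bound) ⟩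
    worstCaseLookups A f ^ 4 * r ^ r ∎) (hard-function m e k A A-filter)

theorem4p1 : Σ ℚ λ c → 0ℚ <ℚ c × ((r d : ℕ) → 4 ≤ r → 2 ∣ r → 2 ^ 16 * r ≤ d →
    (A : LocalAlgorithm d r) → IsLipschitzFilter A →
    Σ (Cube d → Interval r) λ f → AtLeastRatioPower c d r (worstCaseLookups A f))
theorem4p1 = ℤ.+ 1 ℚ./ 4 , ℚₚ.positive⁻¹ (ℤ.+ 1 ℚ./ 4) , main
  where
  main : (r d : ℕ) → 4 ≤ r → 2 ∣ r → 2 ^ 16 * r ≤ d →
    (A : LocalAlgorithm d r) → IsLipschitzFilter A →
    Σ (Cube d → Interval r) λ f → AtLeastRatioPower (ℤ.+ 1 ℚ./ 4) d r (worstCaseLookups A f)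
  -- The cases r = 0 and r = 2 contradict 4 ≤ r; what remains is r = 2(k + 1) with k ≥ 1.
  main _ d () (divides zero refl) _ A A-filter
  main _ d (s≤s (s≤s ())) (divides (suc zero) refl) _ A A-filter
  main r d _ (divides (suc k@(suc _)) refl) 2^16r≤d A A-filter
    = map₂ (λ {f} → subst (λ i → d ^ i ≤ worstCaseLookups A f ^ 4 * r ^ i) (sym (*-identityˡ r)))
        (lower-bound k d (s≤s z≤n) (≤-trans (*-monoˡ-≤ r 128≤2^16) 2^16r≤d) A A-filter)
    where
    128≤2^16 : 128 ≤ 2 ^ 16
    128≤2^16 = ^-monoʳ-≤ 2 {7} {16} (m≤m+n 7 9)
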